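{- For integers $m,k\ge 1$ let \[a(m, k) = |\mathrm{ParseWords}(\mathrm{LeftTurnTree}(m, k+1), \mathrm{RightTurnTree}(k, m+1))|.\] Then for all integers $m \geq 1$, $k \geq 1$, and $n \geq k + 2$, \[|\mathrm{ParseWords}(\mathrm{LeftTurnTree}(m, n), \mathrm{RightTurnTree}(k, m + n - k))| = 2\, a(m, k).\]
   Context: A binary tree is a rooted ordered tree in which each vertex has either $0$ or $2$ children; its leaves are ordered left to right. Let $G$ be the context-free grammar with start symbols $0,1,2$ and rules $0\to 12$, $0\to 21$, $1\to 02$, $1\to 20$, $2\to 01$, $2\to 10$. An $n$-leaf binary tree $T$ parses a word $w$ of length $n$ on $\{0,1,2\}$ if there is a labeling of the vertices of $T$ by $0,1,2$ such that the leaves, from left to right, are labeled with the letters of $w$, and at every internal vertex the label of the vertex together with the labels of its left and right children form a rule of $G$ (i.e. the three labels are pairwise distinct). If $T$ parses $w$, it also parses every word obtained from $w$ by permuting the alphabet $\{0,1,2\}$. For binary trees $T_1,T_2$ with the same number of leaves, $\mathrm{ParseWords}(T_1,T_2)$ denotes the set of equivalence classes (under permutations of the alphabet $\{0,1,2\}$) of words parsed by both $T_1$ and $T_2$. The level of a vertex is its distance from the root. A path tree is a binary tree with at most two vertices on each level. For $N\ge 2$, $N$-leaf path trees correspond bijectively to words $x_1\cdots x_{N-2}$ on $\{l,r\}$: $x_j=l$ (resp. $x_j=r$) means that, of the two vertices on level $j$, the left (resp. right) one has children. $\mathrm{LeftTurnTree}(p,q)$ is the $(p+q)$-leaf path tree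 corresponding to $l^p r^{q-2}$, and $\mathrm{RightTurnTree}(p,q)$ is the $(p+q)$-leaf path tree corresponding to $r^p l^{q-2}$. -}

module Defs where

open import Data.Fin.Base using (Fin; zero; suc)
open import Data.Fin.Patterns using (0F; 1F; 2F)
open import Data.Fin.Permutation
  using (Permutation′; _⟨$⟩ʳ_; _⟨$⟩ˡ_; inverseˡ; inverseʳ; id; flip; _∘ₚ_; transpose)
open import Data.Fin.Properties using (_≟_; all?)
open import Data.List.Base as List
  using (List; []; _∷_; _++_; replicate; length; lookup; allFin; deduplicate;
         cartesianProduct; cartesianProductWith)
open import Data.List.Membership.Propositional using (_∈_; find; lose)
open import Data.List.Membership.Propositional.Properties
  using (∈-cartesianProduct⁺; ∈-cartesianProductWith⁺; ∈-map⁺; ∈-allFin)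
import Data.List.Membership.DecPropositional as DecMembership
import Data.List.Membership.Setoid.Properties as Membershipₛ
open import Data.List.Properties using (≡-dec; map-id; map-∘; map-cong)
import Data.List.Relation.Unary.All as All
open import Data.List.Relation.Unary.AllPairs using (_∷_)
open import Data.List.Relation.Unary.Any as Any using (Any; here; there; any?)
open import Data.List.Relation.Unary.Enumerates.Setoid using (IsEnumeration)
open import Data.List.Relation.Unary.Enumerates.Setoid.Properties
  using (deduplicate⁺; lookup-surjective)
import Data.List.Relation.Unary.Unique.DecSetoid.Properties as Uniqueₛ
import Data.List.Relation.Unary.Unique.Setoid as Unique
open import Data.Nat.Base using (ℕ; _+_; _∸_)
open import Data.Product.Base using (_×_; _,_; ∃; proj₁; proj₂)
import Data.Product.Properties as Product
open import Data.Tree.Binary using (Tree; leaf; node; map; module Leaves)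
open import Data.Unit.Base using (⊤; tt)
open import Function.Base using (const)
open import Function.Bundles using (Bijection)
open import Level using (0ℓ)
open import Relation.Binary.Bundles using (Setoid; DecSetoid)
open import Relation.Binary.Core using (Rel)
open import Relation.Binary.Definitions using (DecidableEquality)
open import Relation.Binary.PropositionalEquality
  using (_≡_; _≢_; refl; sym; trans; cong; setoid)
import Relation.Binary.Construct.On as On
open import Relation.Binary.Structures using (IsEquivalence)
open import Relation.Nullary.Decidable
  using (Dec; yes; no; map′; _×-dec_; _→-dec_; ¬?; from-yes)
open import Relation.Nullary.Negation using (contradiction)

Letter : Set
Letter = Fin 3

Word : Set
Word = List Letter

BinaryTree : Set
BinaryTree = Tree ⊤ ⊤

LabeledTree : Set
LabeledTree = Tree Letter Letter

shape : LabeledTree → BinaryTree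
shape = map (const tt) (const tt)

root : LabeledTree → Letter
root (leaf x)     = x
root (node _ x _) = x

-- (x , y , z) stands for the production x → y z.
rules : List (Letter × Letter × Letter)
rules = (0F , 1F , 2F) ∷ (0F , 2F , 1F)
      ∷ (1F , 0F , 2F) ∷ (1F , 2F , 0F)
      ∷ (2F , 0F , 1F) ∷ (2F , 1F , 0F) ∷ []

IsDerivation : LabeledTree → Set
IsDerivation (leaf _)     = ⊤
IsDerivation (node L x M) =
  (x , root L , root M) ∈ rules × IsDerivation L × IsDerivation M

infix 4 _Parses_
_Parses_ : BinaryTree → Word → Set
T Parses w = ∃ λ L → shape L ≡ T × Leaves.toList L ≡ w × IsDerivation L

infix 4 _∼_
_∼_ : Rel Word 0ℓ
u ∼ v = ∃ λ (π : Permutation′ 3) → List.map (π ⟨$⟩ʳ_) u ≡ v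

data Direction : Set where
  l r : Direction

-- The tree of a word x₁ ⋯ x_{N-2} has N leaves: the root always has
-- children, and x₁ selects the vertex on level 1 that has children.
pathTree : List Direction → BinaryTree
pathTree []       = node (leaf tt) tt (leaf tt)
pathTree (l ∷ xs) = node (pathTree xs) tt (leaf tt)
pathTree (r ∷ xs) = node (leaf tt) tt (pathTree xs)

-- These have p + q leaves for q ≥ 2; the truncated subtraction makes smaller
-- q behave like q = 2.
LeftTurnTree RightTurnTree : ℕ → ℕ → BinaryTree
LeftTurnTree  p q = pathTree (replicate p l ++ replicate (q ∸ 2) r)
RightTurnTree p q = pathTree (replicate p r ++ replicate (q ∸ 2) l)

infix 4 _≟ᵀ_
_≟ᵀ_ : DecidableEquality BinaryTree
leaf _     ≟ᵀ leaf _     = yes refl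
leaf _     ≟ᵀ node _ _ _ = no λ ()
node _ _ _ ≟ᵀ leaf _     = no λ ()
node s _ t ≟ᵀ node u _ v =
  map′ (λ { (refl , refl) → refl }) (λ { refl → refl , refl }) (s ≟ᵀ u ×-dec t ≟ᵀ v)

isDerivation? : ∀ L → Dec (IsDerivation L)
isDerivation? (leaf _)     = yes tt
isDerivation? (node L x M) =
  (x , root L , root M) ∈? rules ×-dec isDerivation? L ×-dec isDerivation? M
  where open DecMembership (Product.≡-dec _≟_ (Product.≡-dec _≟_ _≟_)) using (_∈?_)

join : Letter → LabeledTree × LabeledTree → LabeledTree
join x (L , M) = node L x M

labelings : BinaryTree → List LabeledTree
labelings (leaf _)     = List.map leaf (allFin 3)
labelings (node s _ t) =
  cartesianProductWith join (allFin 3) (cartesianProduct (labelings s) (labelings t))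

∈-labelings : ∀ L → L ∈ labelings (shape L)
∈-labelings (leaf x)     = ∈-map⁺ leaf (∈-allFin x)
∈-labelings (node L x M) = ∈-cartesianProductWith⁺ join (∈-allFin x)
  (∈-cartesianProduct⁺ (∈-labelings L) (∈-labelings M))

infix 4 _Parses?_
_Parses?_ : ∀ T w → Dec (T Parses w)
T Parses? w = map′
  (λ p → let L , _ , q = find p in L , q)
  (λ { (L , q@(refl , _)) → lose (∈-labelings L) q })
  (any? (λ L → shape L ≟ᵀ T ×-dec ≡-dec _≟_ (Leaves.toList L) w ×-dec isDerivation? L)
        (labelings T))

∼-isEquivalence : IsEquivalence _∼_
∼-isEquivalence = record
  { refl  = id , map-id _
  ; sym   = λ { {u} (π , refl) → flip π ,
      trans (sym (map-∘ u)) (trans (map-cong (λ _ → inverseˡ π) u) (map-id u)) }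
  ; trans = λ { {u} (π , refl) (ρ , refl) → π ∘ₚ ρ , map-∘ u }
  }

permutations : List (Permutation′ 3)
permutations = id ∷ transpose 0F 1F ∷ transpose 0F 2F ∷ transpose 1F 2F
             ∷ transpose 0F 1F ∘ₚ transpose 1F 2F
             ∷ transpose 1F 2F ∘ₚ transpose 0F 1F ∷ []

permutations-complete : ∀ x y z → x ≢ y × x ≢ z × y ≢ z →
  Any (λ π → π ⟨$⟩ʳ 0F ≡ x × π ⟨$⟩ʳ 1F ≡ y × π ⟨$⟩ʳ 2F ≡ z) permutations
permutations-complete = from-yes (all? λ x → all? λ y → all? λ z →
  (¬? (x ≟ y) ×-dec ¬? (x ≟ z) ×-dec ¬? (y ≟ z)) →-dec
  any? (λ π → π ⟨$⟩ʳ 0F ≟ x ×-dec π ⟨$⟩ʳ 1F ≟ y ×-dec π ⟨$⟩ʳ 2F ≟ z) permutations)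

infix 4 _∼?_
_∼?_ : ∀ u v → Dec (u ∼ v)
u ∼? v = map′ Any.satisfied complete
  (any? (λ π → ≡-dec _≟_ (List.map (π ⟨$⟩ʳ_) u) v) permutations)
  where
  complete : u ∼ v → Any (λ ρ → List.map (ρ ⟨$⟩ʳ_) u ≡ v) permutations
  complete (π , refl) =
    Any.map (λ (p , q , s) → map-cong (λ { 0F → p ; 1F → q ; 2F → s }) u)
      (permutations-complete _ _ _ (distinct (λ ()) , distinct (λ ()) , distinct (λ ())))
    where
    distinct : ∀ {i j} → i ≢ j → π ⟨$⟩ʳ i ≢ π ⟨$⟩ʳ j
    distinct i≢j eq =
      i≢j (trans (sym (inverseˡ π)) (trans (cong (π ⟨$⟩ˡ_) eq) (inverseˡ π)))

-- Quotients are represented by setoids: the elements are the words parsed by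
-- both trees, and two of them are equal when they lie in the same class.
ParseWords : BinaryTree → BinaryTree → DecSetoid 0ℓ 0ℓ
ParseWords S T = On.decSetoid words (proj₁ {B = λ w → S Parses w × T Parses w})
  where
  words : DecSetoid 0ℓ 0ℓ
  words = record
    { isDecEquivalence = record { isEquivalence = ∼-isEquivalence ; _≟_ = _∼?_ } }

infix 4 _HasCardinality_
_HasCardinality_ : Setoid 0ℓ 0ℓ → ℕ → Set
S HasCardinality n = Bijection (setoid (Fin n)) S

enumeration⇒cardinality : (S : DecSetoid 0ℓ 0ℓ) → ∀ {xs} →
  IsEnumeration (DecSetoid.setoid S) xs → ∃ (DecSetoid.setoid S HasCardinality_)
enumeration⇒cardinality S? {xs} xs-complete = length ys , record
  { to        = lookup ys
  ; cong      = λ { refl → S.refl }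
  ; bijective = injective (Uniqueₛ.deduplicate-! S? xs) _ _
              , lookup-surjective S.setoid (deduplicate⁺ S? xs-complete)
  }
  where
  module S = DecSetoid S?
  open Unique S.setoid using (Unique)

  ys : List S.Carrier
  ys = deduplicate S._≟_ xs

  resp : ∀ {x y z} → y S.≈ z → x S.≉ y → x S.≉ z
  resp y≈z x≉y x≈z = x≉y (S.trans x≈z (S.sym y≈z))

  injective : ∀ {zs} → Unique zs → ∀ i j → lookup zs i S.≈ lookup zs j → i ≡ j
  injective (_ ∷ _)  zero    zero    _  = refl
  injective (p ∷ _)  zero    (suc j) eq =
    contradiction eq (All.lookupₛ S.setoid resp p (Membershipₛ.∈-lookup S.setoid _ j))
  injective (p ∷ _)  (suc i) zero    eq =
    contradiction (S.sym eq)
      (All.lookupₛ S.setoid resp p (Membershipₛ.∈-lookup S.setoid _ i))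
  injective (_ ∷ u)  (suc i) (suc j) eq = cong suc (injective u i j eq)

module _ (S T : BinaryTree) where
  open DecSetoid (ParseWords S T) using (Carrier; _≈_) renaming (setoid to PW)

  select : List LabeledTree → List Carrier
  select []       = []
  select (L ∷ Ls) with S Parses? Leaves.toList L ×-dec T Parses? Leaves.toList L
  ... | yes p = (Leaves.toList L , p) ∷ select Ls
  ... | no  _ = select Ls

  select-complete : ∀ {L Ls} → L ∈ Ls → (c : Carrier) → Leaves.toList L ≡ proj₁ c →
                    Any (c ≈_) (select Ls)
  select-complete {L} (here refl) (_ , p) refl
    with S Parses? Leaves.toList L ×-dec T Parses? Leaves.toList L
  ... | yes _ = here (IsEquivalence.refl ∼-isEquivalence)
  ... | no ¬p = contradiction p ¬p
  select-complete {Ls = M ∷ _} (there L∈Ls) c eq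
    with S Parses? Leaves.toList M ×-dec T Parses? Leaves.toList M
  ... | yes _ = there (select-complete L∈Ls c eq)
  ... | no  _ = select-complete L∈Ls c eq

  ParseWords-finite : ∃ (PW HasCardinality_)
  ParseWords-finite = enumeration⇒cardinality (ParseWords S T)
    {select (labelings S)}
    λ { c@(_ , (L , refl , eq , _) , _) → select-complete (∈-labelings L) c eq }

  -- This number is determined by the setoid: a setoid has at most one cardinality.
  ∣ParseWords∣ : ℕ
  ∣ParseWords∣ = proj₁ ParseWords-finite

a : ℕ → ℕ → ℕ
a m k = ∣ParseWords∣ (LeftTurnTree m (k + 1)) (RightTurnTree k (m + 1))

{-# OPTIONS --safe #-}
module Submission where

-- Both trees have the (k+1)-st leaf of the corresponding small tree replaced by
-- a comb with n − k leaves, a right comb in one tree and a left comb in the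
-- other.  A word parsed by both combs is x c ⋯ c y, where c is the common label
-- of their roots: x ≠ c is free and determines y.  So a class counted by a m k
-- lifts in two ways.  The k-th letter b of its words differs from the (k+1)-st
-- letter c, so the lifts x = b and x = the third letter are distinguished in a
-- way that does not depend on the representative of the class.

open import Defs
open import Data.Fin.Base using (Fin)
open import Data.Fin.Patterns using (0F; 1F; 2F)
open import Data.Fin.Permutation using (Permutation′; _⟨$⟩ʳ_; ↔⇒≡)
open import Data.Fin.Properties using (_≟_; all?; any?; *↔×)
open import Data.List.Base
  using (List; []; _∷_; [_]; _++_; _∷ʳ_; _ʳ++_; map; replicate; reverse; length)
import Data.List.Membership.DecPropositional as DecMembership
open import Data.List.Membership.Propositional using (_∈_)
open import Data.List.Properties
  using ( ++-assoc; map-++; reverse-++; length-++; length-map; length-reverse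
        ; ∷-injective; ∷-injectiveˡ; ∷-injectiveʳ; ∷ʳ-++; ++-cancelˡ
        ; reverse-injective )
open import Data.List.Relation.Binary.Permutation.Propositional.Properties using (++-comm; map⁺)
open import Data.Nat.ListAction using (sum)
open import Data.Nat.ListAction.Properties using (sum-↭)
open import Data.Nat.Base using (ℕ; zero; suc; _+_; _*_; _∸_; _≤_)
import Data.Nat.Properties as ℕ
open import Data.Product.Base using (_×_; _,_; ∃; ∃₂; proj₁; proj₂)
import Data.Product.Properties as Product
open import Data.Tree.Binary using (leaf; node; module Leaves)
open import Data.Unit.Base using (tt)
open import Function.Base using (_∘_)
open import Function.Bundles using (Bijection; Injection)
import Function.Properties.Bijection as Bij
open import Function.Properties.Inverse as Inv using (↔⇒↣)
open import Level using (0ℓ)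
open import Relation.Binary.Bundles using (Setoid; DecSetoid)
open import Relation.Binary.Structures using (IsEquivalence)
open import Relation.Binary.PropositionalEquality
  using (_≡_; _≢_; refl; sym; trans; cong; cong₂; setoid; module ≡-Reasoning)
open import Relation.Nullary.Decidable using (Dec; yes; no; _×-dec_; _→-dec_; ¬?; from-yes)

-- Letters and rules.

Rule : Letter → Letter → Letter → Set
Rule x y z = (x , y , z) ∈ rules

rule? : ∀ x y z → Dec (Rule x y z)
rule? x y z = (x , y , z) ∈? rules
  where open DecMembership (Product.≡-dec _≟_ (Product.≡-dec _≟_ _≟_)) using (_∈?_)

-- The third letter; the choice x ⊕ x = x turns the letters into a quasigroup.
infixl 6 _⊕_
_⊕_ : Letter → Letter → Letter
0F ⊕ 0F = 0F
0F ⊕ 1F = 2F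
0F ⊕ 2F = 1F
1F ⊕ 0F = 2F
1F ⊕ 1F = 1F
1F ⊕ 2F = 0F
2F ⊕ 0F = 1F
2F ⊕ 1F = 0F
2F ⊕ 2F = 2F

⊕-idem : ∀ x → x ⊕ x ≡ x
⊕-idem = from-yes (all? λ x → x ⊕ x ≟ x)

⊕-comm : ∀ x y → x ⊕ y ≡ y ⊕ x
⊕-comm = from-yes (all? λ x → all? λ y → x ⊕ y ≟ y ⊕ x)

⊕-involutiveʳ : ∀ x y → x ⊕ y ⊕ y ≡ x
⊕-involutiveʳ = from-yes (all? λ x → all? λ y → x ⊕ y ⊕ y ≟ x)

⊕-involutiveˡ : ∀ x y → x ⊕ (x ⊕ y) ≡ y
⊕-involutiveˡ = from-yes (all? λ x → all? λ y → x ⊕ (x ⊕ y) ≟ y)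

⊕≢ʳ : ∀ x y → x ≢ y → x ⊕ y ≢ y
⊕≢ʳ = from-yes (all? λ x → all? λ y → ¬? (x ≟ y) →-dec ¬? (x ⊕ y ≟ y))

⊕-unique : ∀ x y z → x ≢ y × z ≢ x × z ≢ y → z ≡ x ⊕ y
⊕-unique = from-yes (all? λ x → all? λ y → all? λ z →
  (¬? (x ≟ y) ×-dec ¬? (z ≟ x) ×-dec ¬? (z ≟ y)) →-dec z ≟ x ⊕ y)

⊕-cancelˡ : ∀ x {y z} → x ⊕ y ≡ x ⊕ z → y ≡ z
⊕-cancelˡ x {y} {z} eq =
  trans (sym (⊕-involutiveˡ x y)) (trans (cong (x ⊕_) eq) (⊕-involutiveˡ x z))

rename-injective : ∀ (π : Permutation′ 3) {x y} → π ⟨$⟩ʳ x ≡ π ⟨$⟩ʳ y → x ≡ y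
rename-injective π = Injection.injective (↔⇒↣ π)

-- Injectivity keeps distinct letters distinct, so the third letter goes to the third letter.
-- Bridges and lifts, being built from `⊕`, therefore commute with renaming.
rename-⊕ : ∀ (π : Permutation′ 3) x y → π ⟨$⟩ʳ (x ⊕ y) ≡ (π ⟨$⟩ʳ x) ⊕ (π ⟨$⟩ʳ y)
rename-⊕ π x y with x ≟ y
... | yes refl = trans (cong (π ⟨$⟩ʳ_) (⊕-idem x)) (sym (⊕-idem _))
... | no  x≢y  = ⊕-unique _ _ _
  ( x≢y ∘ rename-injective π
  , ⊕≢ʳ y x (x≢y ∘ sym) ∘ trans (⊕-comm y x) ∘ rename-injective π
  , ⊕≢ʳ x y x≢y ∘ rename-injective π )

abstract
  rule-≢ : ∀ {x y z} → Rule x y z → y ≢ z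
  rule-≢ {x} {y} {z} = from-yes (all? λ x → all? λ y → all? λ z →
    rule? x y z →-dec ¬? (y ≟ z)) x y z

  rule-⊕ : ∀ {x y z} → Rule x y z → x ≡ y ⊕ z
  rule-⊕ {x} {y} {z} = from-yes (all? λ x → all? λ y → all? λ z →
    rule? x y z →-dec x ≟ y ⊕ z) x y z

  rule⁺ : ∀ x c → x ≢ c → Rule c x (x ⊕ c)
  rule⁺ = from-yes (all? λ x → all? λ c → ¬? (x ≟ c) →-dec rule? c x (x ⊕ c))

  rule⁺′ : ∀ x c → x ≢ c → Rule (x ⊕ c) x c
  rule⁺′ = from-yes (all? λ x → all? λ c → ¬? (x ≟ c) →-dec rule? (x ⊕ c) x c)

  rule⁺″ : ∀ x c → x ≢ c → Rule x c (x ⊕ c)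
  rule⁺″ = from-yes (all? λ x → all? λ c → ¬? (x ≟ c) →-dec rule? x c (x ⊕ c))

  rule-≢ˡ : ∀ {x y z} → Rule x y z → y ≢ x
  rule-≢ˡ {x} {y} {z} = from-yes (all? λ x → all? λ y → all? λ z →
    rule? x y z →-dec ¬? (y ≟ x)) x y z

  -- `z` differs from `p` and `q`, so it is the third letter, and the other two labels are forced.
  -- This is one exchange along the combs: the prefix label passes from `p` to `q`, the suffix label
  -- from `q` to `p`.
  rules-overlap : ∀ p q {p′ q′ z} → p ≢ q → Rule q z q′ → Rule p′ p z →
                  q′ ≡ p × p′ ≡ q × z ≡ p ⊕ q
  rules-overlap p q {p′} {q′} {z} p≢q ρ σ = from-yes
    (all? λ p → all? λ q → all? λ p′ → all? λ q′ → all? λ z →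
      (¬? (p ≟ q) ×-dec rule? q z q′ ×-dec rule? p′ p z) →-dec
      (q′ ≟ p ×-dec p′ ≟ q ×-dec z ≟ p ⊕ q)) p q p′ q′ z (p≢q , ρ , σ)

-- Cancellation and repetition in lists.

++-injective : ∀ {A : Set} (xs xs′ : List A) {ys ys′} → length xs ≡ length xs′ →
               xs ++ ys ≡ xs′ ++ ys′ → xs ≡ xs′ × ys ≡ ys′
++-injective []       []         _   eq = refl , eq
++-injective (x ∷ xs) (x′ ∷ xs′) len eq
  with refl , eq′ ← ∷-injective eq
  with refl , eq″ ← ++-injective xs xs′ (ℕ.suc-injective len) eq′ = refl , eq″

++-injective′ : ∀ {A : Set} (xs xs′ : List A) {ys ys′} → length ys ≡ length ys′ →
                xs ++ ys ≡ xs′ ++ ys′ → xs ≡ xs′ × ys ≡ ys′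
++-injective′ xs xs′ {ys} {ys′} len eq = ++-injective xs xs′
  (ℕ.+-cancelʳ-≡ (length ys) _ _ (trans (sym (length-++ xs))
    (trans (cong length eq) (trans (length-++ xs′) (cong (length xs′ +_) (sym len))))))
  eq

replicate-+ : ∀ {A : Set} m n (x : A) → replicate (m + n) x ≡ replicate m x ++ replicate n x
replicate-+ zero    n x = refl
replicate-+ (suc m) n x = cong (x ∷_) (replicate-+ m n x)

replicate-∷ʳ : ∀ {A : Set} n (x : A) → replicate n x ∷ʳ x ≡ replicate (suc n) x
replicate-∷ʳ zero    x = refl
replicate-∷ʳ (suc n) x = cong (x ∷_) (replicate-∷ʳ n x)

-- Labeled paths.

-- Spine ds u v c x: following ds from a vertex labeled x leads to a vertex
-- labeled c.  The siblings of the vertices on the way are leaves: u lists those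
-- on the left, v those on the right, both from the outermost one inwards.
data Spine : List Direction → Word → Word → Letter → Letter → Set where
  []  : ∀ {x} → Spine [] [] [] x x
  _◁_ : ∀ {ds u v c x y z} → Rule x y z → Spine ds u v c y → Spine (l ∷ ds) u (z ∷ v) c x
  _▷_ : ∀ {ds u v c x y z} → Rule x y z → Spine ds u v c z → Spine (r ∷ ds) (y ∷ u) v c x

infixr 5 _◁_ _▷_

word : Word → Letter → Word → Word
word u c v = u ++ c ∷ reverse v

spine-++⁺ : ∀ {ds es u₁ u₂ v₁ v₂ c d x} → Spine ds u₁ v₁ d x → Spine es u₂ v₂ c d →
            Spine (ds ++ es) (u₁ ++ u₂) (v₁ ++ v₂) c x
spine-++⁺ []      t = t
spine-++⁺ (ρ ◁ s) t = ρ ◁ spine-++⁺ s t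
spine-++⁺ (ρ ▷ s) t = ρ ▷ spine-++⁺ s t

spine-++⁻ : ∀ ds {es u v c x} → Spine (ds ++ es) u v c x →
            ∃₂ λ u₁ v₁ → ∃₂ λ u₂ v₂ → ∃ λ d →
            u ≡ u₁ ++ u₂ × v ≡ v₁ ++ v₂ × Spine ds u₁ v₁ d x × Spine es u₂ v₂ c d
spine-++⁻ [] s = [] , [] , _ , _ , _ , refl , refl , [] , s
spine-++⁻ (l ∷ ds) (ρ ◁ s) with _ , _ , _ , _ , _ , p , q , t , t′ ← spine-++⁻ ds s =
  _ , _ , _ , _ , _ , p , cong (_ ∷_) q , ρ ◁ t , t′
spine-++⁻ (r ∷ ds) (ρ ▷ s) with _ , _ , _ , _ , _ , p , q , t , t′ ← spine-++⁻ ds s =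
  _ , _ , _ , _ , _ , cong (_ ∷_) p , q , ρ ▷ t , t′

word-++ : ∀ u₁ u₂ c v₁ v₂ → word (u₁ ++ u₂) c (v₁ ++ v₂) ≡ u₁ ++ word u₂ c v₂ ++ reverse v₁
word-++ u₁ u₂ c v₁ v₂ = begin
  (u₁ ++ u₂) ++ c ∷ reverse (v₁ ++ v₂)        ≡⟨ ++-assoc u₁ u₂ _ ⟩
  u₁ ++ u₂ ++ c ∷ reverse (v₁ ++ v₂)          ≡⟨ cong (λ w → u₁ ++ u₂ ++ c ∷ w) (reverse-++ v₁ v₂) ⟩
  u₁ ++ u₂ ++ c ∷ reverse v₂ ++ reverse v₁    ≡⟨ cong (u₁ ++_) (++-assoc u₂ _ _) ⟨
  u₁ ++ (u₂ ++ c ∷ reverse v₂) ++ reverse v₁  ∎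
  where open ≡-Reasoning

-- Words parsed by path trees.

-- Used for paths that run down to a leaf, hence one step longer than the word of the path tree.
Spells : List Direction → Word → Set
Spells ds w = ∃ λ u → ∃₂ λ v c → ∃ λ x → w ≡ word u c v × Spine ds u v c x

node-injective : ∀ {s t s′ t′ : BinaryTree} → node s tt t ≡ node s′ tt t′ → s ≡ s′ × t ≡ t′
node-injective refl = refl , refl

-- The last vertex of a path tree with children has two leaves as its children,
-- so its path may be extended by a step in either direction.
derivation⇒spine : ∀ ds d L → shape L ≡ pathTree ds → IsDerivation L →
  ∃ λ u → ∃₂ λ v c → (∀ k → Leaves.toDiffList L k ≡ u ++ c ∷ v ʳ++ k) ×
                     Spine (ds ∷ʳ d) u v c (root L)
derivation⇒spine [] l (node (leaf y) x (leaf z)) _ (ρ , _) =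
  [] , [ z ] , y , (λ _ → refl) , ρ ◁ []
derivation⇒spine [] r (node (leaf y) x (leaf z)) _ (ρ , _) =
  [ y ] , [] , z , (λ _ → refl) , ρ ▷ []
derivation⇒spine (l ∷ ds) d (node L x (leaf z)) eq (ρ , δ , _)
  with u , v , c , p , s ← derivation⇒spine ds d L (proj₁ (node-injective eq)) δ =
  u , z ∷ v , c , (λ k → p (z ∷ k)) , ρ ◁ s
derivation⇒spine (r ∷ ds) d (node (leaf y) x L) eq (ρ , _ , δ)
  with u , v , c , p , s ← derivation⇒spine ds d L (proj₂ (node-injective eq)) δ =
  y ∷ u , v , c , (λ k → cong (y ∷_) (p k)) , ρ ▷ s
derivation⇒spine [] _ (leaf _) () _
derivation⇒spine [] _ (node (leaf _) _ (node _ _ _)) () _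
derivation⇒spine [] _ (node (node _ _ _) _ _) () _
derivation⇒spine (l ∷ _) _ (leaf _) () _
derivation⇒spine (l ∷ _) _ (node _ _ (node _ _ _)) () _
derivation⇒spine (r ∷ _) _ (leaf _) () _
derivation⇒spine (r ∷ _) _ (node (node _ _ _) _ _) () _

-- The continuation `k` spares the induction any associativity: a right sibling is pushed onto `k`,
-- just as `ʳ++` treats the head of its first list.
spine⇒derivation : ∀ ds d {u v c x} → Spine (ds ∷ʳ d) u v c x →
  ∃ λ L → shape L ≡ pathTree ds × (∀ k → Leaves.toDiffList L k ≡ u ++ c ∷ v ʳ++ k) ×
          IsDerivation L × root L ≡ x
spine⇒derivation [] l (ρ ◁ []) =
  node (leaf _) _ (leaf _) , refl , (λ _ → refl) , (ρ , tt , tt) , refl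
spine⇒derivation [] r (ρ ▷ []) =
  node (leaf _) _ (leaf _) , refl , (λ _ → refl) , (ρ , tt , tt) , refl
spine⇒derivation (l ∷ ds) d (ρ ◁ s) with L , p , q , δ , refl ← spine⇒derivation ds d s =
  node L _ (leaf _) , cong (λ t → node t tt (leaf tt)) p , (λ k → q (_ ∷ k)) , (ρ , δ , tt) , refl
spine⇒derivation (r ∷ ds) d (ρ ▷ s) with L , p , q , δ , refl ← spine⇒derivation ds d s =
  node (leaf _) _ L , cong (node (leaf tt) tt) p , (λ k → cong (_ ∷_) (q k)) , (ρ , tt , δ) , refl

parses⇒spells : ∀ ds d {es w} → ds ∷ʳ d ≡ es → pathTree ds Parses w → Spells es w
parses⇒spells ds d refl (L , p , refl , δ)
  with u , v , c , q , s ← derivation⇒spine ds d L p δ = u , v , c , _ , q [] , s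

spells⇒parses : ∀ ds d {es w} → ds ∷ʳ d ≡ es → Spells es w → pathTree ds Parses w
spells⇒parses ds d refl (u , v , c , x , refl , s)
  with L , p , q , δ , _ ← spine⇒derivation ds d s = L , p , q [] , δ

-- Position of the end of a path.

isLeft isRight : Direction → ℕ
isLeft  l = 1
isLeft  r = 0
isRight l = 0
isRight r = 1

count : (Direction → ℕ) → List Direction → ℕ
count f ds = sum (map f ds)

count-++-comm : ∀ f ds es → count f (ds ++ es) ≡ count f (es ++ ds)
count-++-comm f ds es = sum-↭ (map⁺ f (++-comm ds es))

-- The sibling of a right child stands on the left, hence `isRight` for the left leaves.
spine-lengthˡ : ∀ {ds u v c x} → Spine ds u v c x → length u ≡ count isRight ds
spine-lengthˡ []      = refl
spine-lengthˡ (_ ◁ s) = spine-lengthˡ s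
spine-lengthˡ (_ ▷ s) = cong suc (spine-lengthˡ s)

spine-lengthʳ : ∀ {ds u v c x} → Spine ds u v c x → length v ≡ count isLeft ds
spine-lengthʳ []      = refl
spine-lengthʳ (_ ◁ s) = cong suc (spine-lengthʳ s)
spine-lengthʳ (_ ▷ s) = spine-lengthʳ s

-- `b` labels the left sibling of the endpoint, and siblings carry different letters. It is the
-- reference letter for the two lifts.
spine-∷ʳr : ∀ ds {u v c x} → Spine (ds ∷ʳ r) u v c x → ∃₂ λ u₀ b → u ≡ u₀ ∷ʳ b × b ≢ c
spine-∷ʳr []       (ρ ▷ []) = [] , _ , refl , rule-≢ ρ
spine-∷ʳr (l ∷ ds) (ρ ◁ s)  = spine-∷ʳr ds s
spine-∷ʳr (r ∷ ds) (ρ ▷ s) with u₀ , b , refl , b≢c ← spine-∷ʳr ds s =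
  _ ∷ u₀ , b , refl , b≢c

-- Combs

-- bridge j c x is the word c ⋯ c y with j letters c for which x c ⋯ c y is
-- parsed by both combs, with root label c.
bridge : ℕ → Letter → Letter → Word
bridge zero    c x = [ x ⊕ c ]
bridge (suc j) c x = c ∷ bridge j c (x ⊕ c)

bridge-injective : ∀ j {x c c′ s t} → bridge j c x ++ s ≡ bridge j c′ x ++ t → c ≡ c′ × s ≡ t
bridge-injective zero {x} eq = ⊕-cancelˡ x (∷-injectiveˡ eq) , ∷-injectiveʳ eq
bridge-injective (suc j) {x} {c} eq with refl , eq′ ← ∷-injective eq =
  refl , ++-cancelˡ (bridge j c (x ⊕ c)) _ _ eq′

map-bridge : ∀ (π : Permutation′ 3) j c x →
  map (π ⟨$⟩ʳ_) (bridge j c x) ≡ bridge j (π ⟨$⟩ʳ c) (π ⟨$⟩ʳ x)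
map-bridge π zero    c x = cong [_] (rename-⊕ π x c)
map-bridge π (suc j) c x = cong (_ ∷_) (trans (map-bridge π j c (x ⊕ c))
  (cong (bridge j _) (rename-⊕ π x c)))

-- `Spine` grows at the root, but the word of a left comb, read from the left, starts at its
-- innermost vertex; this and the next lemma attach and detach a step at that end.
left-comb-inner⁺ : ∀ j {v p p′ z x} → Spine (replicate j l) [] v p′ x → Rule p′ p z →
                   Spine (replicate (suc j) l) [] (v ∷ʳ z) p x
left-comb-inner⁺ zero    []      σ = σ ◁ []
left-comb-inner⁺ (suc j) (ρ ◁ s) σ = ρ ◁ left-comb-inner⁺ j s σ

left-comb-inner⁻ : ∀ j {v p x} → Spine (replicate (suc j) l) [] v p x →
  ∃₂ λ v′ p′ → ∃ λ z → v ≡ v′ ∷ʳ z × Spine (replicate j l) [] v′ p′ x × Rule p′ p z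
left-comb-inner⁻ zero    (ρ ◁ []) = [] , _ , _ , refl , [] , ρ
left-comb-inner⁻ (suc j) (ρ ◁ s) with v′ , p′ , z , refl , t , σ ← left-comb-inner⁻ j s =
  _ ∷ v′ , p′ , z , refl , ρ ◁ t , σ

-- Let all left siblings be `c`; the labels down the comb then alternate between `q` and `q ⊕ c`.
right-comb-bridge : ∀ j {c q} → q ≢ c → ∃₂ λ u e →
  Spine (replicate j r) u [] e q × u ∷ʳ e ≡ bridge j c (q ⊕ c)
right-comb-bridge zero    {c} {q} q≢c = [] , q , [] , cong [_] (sym (⊕-involutiveʳ q c))
right-comb-bridge (suc j) {c} {q} q≢c
  with u , e , s , eq ← right-comb-bridge j {c} {q ⊕ c} (⊕≢ʳ q c q≢c) =
  c ∷ u , e , rule⁺″ q c q≢c ▷ s , cong (c ∷_) eq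

-- Going up from the innermost vertex, each sibling `c` exchanges the labels `x` and `x ⊕ c`; the
-- outermost sibling is the remaining letter, which makes the root `c`.
left-comb-bridge : ∀ j {c x} → x ≢ c →
  ∃ λ v → Spine (replicate (suc j) l) [] v x c × reverse v ≡ bridge j c x
left-comb-bridge zero    {c} {x} x≢c = [ x ⊕ c ] , rule⁺ x c x≢c ◁ [] , refl
left-comb-bridge (suc j) {c} {x} x≢c
  with v , s , eq ← left-comb-bridge j {c} {x ⊕ c} (⊕≢ʳ x c x≢c) =
  v ∷ʳ c , left-comb-inner⁺ (suc j) s (rule⁺′ x c x≢c) ,
  trans (reverse-++ v [ c ]) (cong (c ∷_) eq)

-- Reading from the left, the label p of the prefix (left comb) and the label q
-- of the remaining suffix (right comb) are exchanged by every inner letter.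
combs⇒bridge : ∀ j {u e q v p d} → p ≢ q →
  Spine (replicate j r) u [] e q → Spine (replicate (suc j) l) [] v p d →
  u ∷ʳ e ≡ reverse v → d ≡ p ⊕ q × reverse v ≡ bridge j (p ⊕ q) p
combs⇒bridge zero {q = q} {p = p} p≢q [] (ρ ◁ []) refl =
  rule-⊕ ρ , cong [_] (sym (⊕-involutiveˡ p q))
combs⇒bridge (suc j) {q = q} {p = p} p≢q (ρ ▷ s) t eq
  with v′ , p′ , z , refl , t′ , σ ← left-comb-inner⁻ (suc j) t
  with refl , eq′ ← ∷-injective (trans eq (reverse-++ v′ [ z ]))
  with refl , refl , refl ← rules-overlap p q p≢q ρ σ
  with d≡ , v≡ ← combs⇒bridge j (p≢q ∘ sym) s t′ eq′ =
  trans d≡ (⊕-comm q p) ,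
  trans (reverse-++ v′ _) (cong (_ ∷_)
    (trans v≡ (cong₂ (bridge j) (⊕-comm q p) (sym (⊕-involutiveˡ p q)))))

right-comb-noʳ : ∀ j {u v c x} → Spine (replicate j r) u v c x → v ≡ []
right-comb-noʳ zero    []      = refl
right-comb-noʳ (suc j) (_ ▷ s) = right-comb-noʳ j s

left-comb-noˡ : ∀ j {u v c x} → Spine (replicate j l) u v c x → u ≡ []
left-comb-noˡ zero    []      = refl
left-comb-noˡ (suc j) (_ ◁ s) = left-comb-noˡ j s

-- Lifting words

choose : Fin 2 → Letter → Letter → Letter
choose 0F b c = b
choose 1F b c = b ⊕ c

choose-≢ : ∀ i b c → b ≢ c → choose i b c ≢ c
choose-≢ 0F b c b≢c = b≢c
choose-≢ 1F b c b≢c = ⊕≢ʳ b c b≢c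

choose-injective : ∀ i i′ b c → b ≢ c × choose i b c ≡ choose i′ b c → i ≡ i′
choose-injective = from-yes (all? λ i → all? λ i′ → all? λ b → all? λ c →
  (¬? (b ≟ c) ×-dec choose i b c ≟ choose i′ b c) →-dec i ≟ i′)

choose-surjective : ∀ b c x → b ≢ c × x ≢ c → ∃ λ i → choose i b c ≡ x
choose-surjective = from-yes (all? λ b → all? λ c → all? λ x →
  (¬? (b ≟ c) ×-dec ¬? (x ≟ c)) →-dec any? (λ i → choose i b c ≟ x))

rename-choose : ∀ (π : Permutation′ 3) i b c →
  π ⟨$⟩ʳ choose i b c ≡ choose i (π ⟨$⟩ʳ b) (π ⟨$⟩ʳ c)
rename-choose π 0F b c = refl
rename-choose π 1F b c = rename-⊕ π b c

-- A word cut at the leaf to be replaced: `c` is the letter of that leaf, `b` the letter before it.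
-- A short word and its lifts share the same parts.
record Parts : Set where
  constructor parts
  field
    before : Word
    b c    : Letter
    after  : Word

open Parts

rename : Permutation′ 3 → Parts → Parts
rename π (parts u b c t) =
  parts (map (π ⟨$⟩ʳ_) u) (π ⟨$⟩ʳ b) (π ⟨$⟩ʳ c) (map (π ⟨$⟩ʳ_) t)

short : Parts → Word
short (parts u b c t) = u ++ b ∷ c ∷ t

long : ℕ → Fin 2 → Parts → Word
long j i (parts u b c t) = u ++ b ∷ choose i b c ∷ bridge j c (choose i b c) ++ t

map-short : ∀ π P → map (π ⟨$⟩ʳ_) (short P) ≡ short (rename π P)
map-short π (parts u b c t) = map-++ (π ⟨$⟩ʳ_) u (b ∷ c ∷ t)

map-long : ∀ π j i P → map (π ⟨$⟩ʳ_) (long j i P) ≡ long j i (rename π P)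
map-long π j i (parts u b c t) = begin
  f (u ++ b ∷ x ∷ bridge j c x ++ t)
    ≡⟨ map-++ (π ⟨$⟩ʳ_) u _ ⟩
  f u ++ πb ∷ (π ⟨$⟩ʳ x) ∷ f (bridge j c x ++ t)
    ≡⟨ cong (λ w → f u ++ πb ∷ (π ⟨$⟩ʳ x) ∷ w) (map-++ (π ⟨$⟩ʳ_) (bridge j c x) t) ⟩
  f u ++ πb ∷ (π ⟨$⟩ʳ x) ∷ f (bridge j c x) ++ f t
    ≡⟨ cong (λ w → f u ++ πb ∷ (π ⟨$⟩ʳ x) ∷ w ++ f t) (map-bridge π j c x) ⟩
  f u ++ πb ∷ (π ⟨$⟩ʳ x) ∷ bridge j πc (π ⟨$⟩ʳ x) ++ f t
    ≡⟨ cong (λ y → f u ++ πb ∷ y ∷ bridge j πc y ++ f t) (rename-choose π i b c) ⟩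
  f u ++ πb ∷ choose i πb πc ∷ bridge j πc (choose i πb πc) ++ f t ∎
  where
  open ≡-Reasoning
  f = map (π ⟨$⟩ʳ_)
  x = choose i b c
  πb = π ⟨$⟩ʳ b
  πc = π ⟨$⟩ʳ c

short-injective : ∀ P Q → length (before P) ≡ length (before Q) → short P ≡ short Q → P ≡ Q
short-injective (parts u _ _ _) (parts u′ _ _ _) len eq
  with refl , refl ← ++-injective u u′ len eq = refl

-- Read from the left: the prefix and `b`, then the chosen letter, then `c` from the bridge;
-- comparing the chosen letter with `b` gives `i`.
long-injective : ∀ j i i′ P Q → b P ≢ c P → length (before P) ≡ length (before Q) →
                 long j i P ≡ long j i′ Q → i ≡ i′ × P ≡ Q
long-injective j i i′ (parts u b c _) (parts u′ _ _ _) b≢c len eq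
  with refl , eq₁ ← ++-injective u u′ len eq
  with refl , eq₂ ← ∷-injective eq₁
  with x≡ , eq₃ ← ∷-injective eq₂
  -- `bridge-injective` compares bridges that follow the same letter.
  rewrite sym x≡
  with refl , refl ← bridge-injective j eq₃ =
  choose-injective i i′ b c (b≢c , x≡) , refl

-- `ds` and `es` lead to the replaced leaf in the two trees. Equal step counts put it at the same
-- position in the word, and the last step `r` of `ds` supplies the left sibling `b`.
module Lifting
  (ds₀ es : List Direction) (j : ℕ)
  (sameˡ : ∀ f → count f (ds₀ ∷ʳ r) ≡ count f es)
  where

  ds : List Direction
  ds = ds₀ ∷ʳ r

  Valid : Parts → Set
  Valid (parts u b c t) = b ≢ c × ∃ λ v → reverse v ≡ t ×
    (∃ λ x → Spine ds (u ∷ʳ b) v c x) × (∃ λ x → Spine es (u ∷ʳ b) v c x)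

  valid-length : ∀ P → Valid P → length (before P) + 1 ≡ count isRight ds
  valid-length (parts u b c t) (_ , _ , _ , (_ , s) , _) =
    trans (sym (length-++ u)) (spine-lengthˡ s)

  -- The path dictates the cut position, so a word has at most one decomposition into valid parts.
  valid-≡-length : ∀ P Q → Valid P → Valid Q → length (before P) ≡ length (before Q)
  valid-≡-length P Q p q =
    ℕ.+-cancelʳ-≡ 1 _ _ (trans (valid-length P p) (sym (valid-length Q q)))

  ≡-lengthˡ : ∀ {u v c x u′ v′ c′ x′} → Spine ds u v c x → Spine es u′ v′ c′ x′ →
              length u ≡ length u′
  ≡-lengthˡ s t = trans (spine-lengthˡ s) (trans (sameˡ isRight) (sym (spine-lengthˡ t)))

  ≡-lengthʳ : ∀ {u v c x u′ v′ c′ x′} → Spine ds u v c x → Spine es u′ v′ c′ x′ →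
              length (reverse v) ≡ length (reverse v′)
  ≡-lengthʳ {v = v} {v′ = v′} s t = trans (length-reverse v) (trans (spine-lengthʳ s)
    (trans (sameˡ isLeft) (sym (trans (length-reverse v′) (spine-lengthʳ t)))))

  short⁻ : ∀ {w} → Spells ds w → Spells es w → ∃ λ P → w ≡ short P × Valid P
  short⁻ (u , v , c , _ , refl , s) (u′ , v′ , c′ , _ , eq , t)
    with refl , eq′ ← ++-injective u u′ (≡-lengthˡ s t) eq
    with refl , eq″ ← ∷-injective eq′
    with refl ← reverse-injective {x = v} {v′} eq″
    with u₀ , b , refl , b≢c ← spine-∷ʳr ds₀ s =
    parts u₀ b c (reverse v) , ∷ʳ-++ u₀ b _ , b≢c , v , refl , (_ , s) , (_ , t)

  short⁺ : ∀ P → Valid P → Spells ds (short P) × Spells es (short P)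
  short⁺ (parts u b c _) (_ , v , refl , (_ , s) , (_ , t)) =
    (_ , _ , _ , _ , sym (∷ʳ-++ u b _) , s) , (_ , _ , _ , _ , sym (∷ʳ-++ u b _) , t)

  -- Prefix and suffix have lengths fixed by the paths, so both trees leave the same middle word to
  -- their combs, and `combs⇒bridge` identifies it.
  long⁻ : ∀ {w} → Spells (ds ++ replicate (suc j) r) w → Spells (es ++ replicate (suc j) l) w →
          ∃₂ λ i P → w ≡ long j i P × Valid P
  long⁻ (u , v , e , _ , refl , s) (u′ , v′ , e′ , _ , eq , t)
    -- The first leaf `x` of the right comb is split off: `combs⇒bridge` starts with `x` as the
    -- prefix and the rest as the suffix.
    with u₁ , v₁ , x ∷ u₂ , v₂ , d , refl , refl , s₁ , ρ ▷ s₂ ← spine-++⁻ ds s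
    with u₁′ , v₁′ , u₂′ , v₂′ , d′ , refl , refl , t₁ , t₂ ← spine-++⁻ es t
    with refl ← right-comb-noʳ j s₂
    with refl ← left-comb-noˡ (suc j) t₂
    with eq₀ ← trans (sym (word-++ u₁ (x ∷ u₂) e v₁ [])) (trans eq (word-++ u₁′ [] e′ v₁′ v₂′))
    with refl , eq₁ ← ++-injective u₁ u₁′ (≡-lengthˡ s₁ t₁) eq₀
    with eq₂ , eq₃ ← ++-injective′ ((x ∷ u₂) ∷ʳ e) (e′ ∷ reverse v₂′) (≡-lengthʳ s₁ t₁) eq₁
    with refl , eq₄ ← ∷-injective eq₂
    with refl ← reverse-injective {x = v₁} {v₁′} eq₃
    with d′≡ , v₂′≡ ← combs⇒bridge j (rule-≢ ρ) s₂ t₂ eq₄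
    -- Both comb roots are the third letter beside `x` and the label of its sibling in the right
    -- comb, so the replaced leaf carries the same letter in both trees.
    with refl ← trans d′≡ (sym (rule-⊕ ρ))
    with u₀ , b , refl , b≢d ← spine-∷ʳr ds₀ s₁
    with i , refl ← choose-surjective b d x (b≢d , rule-≢ˡ ρ) =
    i , parts u₀ b d (reverse v₁) ,
    (begin
      word ((u₀ ∷ʳ b) ++ x ∷ u₂) e (v₁ ++ [])
        ≡⟨ word-++ (u₀ ∷ʳ b) (x ∷ u₂) e v₁ [] ⟩
      (u₀ ∷ʳ b) ++ x ∷ (u₂ ∷ʳ e) ++ reverse v₁
        ≡⟨ cong (λ m → (u₀ ∷ʳ b) ++ x ∷ m ++ reverse v₁)
             (trans eq₄ (trans v₂′≡ (cong (λ y → bridge j y x) (sym (rule-⊕ ρ))))) ⟩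
      (u₀ ∷ʳ b) ++ x ∷ bridge j d x ++ reverse v₁
        ≡⟨ ∷ʳ-++ u₀ b _ ⟩
      u₀ ++ b ∷ x ∷ bridge j d x ++ reverse v₁ ∎) ,
    b≢d , v₁ , refl , (_ , s₁) , (_ , t₁)
    where open ≡-Reasoning

  long⁺ : ∀ i P → Valid P → Spells (ds ++ replicate (suc j) r) (long j i P) ×
                            Spells (es ++ replicate (suc j) l) (long j i P)
  long⁺ i (parts u b c _) (b≢c , v , refl , (_ , s) , (_ , t))
    with x ← choose i b c | x≢c ← choose-≢ i b c b≢c
    -- In the right comb, `x ⊕ c` labels the sibling of the leaf `x`.
    with u₂ , e , s₂ , eq ← right-comb-bridge j {c} {x ⊕ c} (⊕≢ʳ x c x≢c)
    with v₂ , t₂ , eq′ ← left-comb-bridge j x≢c =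
    ( _ , _ , _ , _
    , (begin
        u ++ b ∷ x ∷ bridge j c x ++ reverse v
          ≡⟨ ∷ʳ-++ u b _ ⟨
        (u ∷ʳ b) ++ x ∷ bridge j c x ++ reverse v
          ≡⟨ cong (λ m → (u ∷ʳ b) ++ x ∷ m ++ reverse v)
               (trans eq (cong (bridge j c) (⊕-involutiveʳ x c))) ⟨
        (u ∷ʳ b) ++ x ∷ (u₂ ∷ʳ e) ++ reverse v
          ≡⟨ word-++ (u ∷ʳ b) (x ∷ u₂) e v [] ⟨
        word ((u ∷ʳ b) ++ x ∷ u₂) e (v ++ []) ∎)
    , spine-++⁺ s (rule⁺ x c x≢c ▷ s₂) ) ,
    ( _ , _ , _ , _
    , (begin
        u ++ b ∷ x ∷ bridge j c x ++ reverse v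
          ≡⟨ ∷ʳ-++ u b _ ⟨
        (u ∷ʳ b) ++ x ∷ bridge j c x ++ reverse v
          ≡⟨ cong (λ m → (u ∷ʳ b) ++ x ∷ m ++ reverse v) eq′ ⟨
        (u ∷ʳ b) ++ x ∷ reverse v₂ ++ reverse v
          ≡⟨ word-++ (u ∷ʳ b) [] x v v₂ ⟨
        word ((u ∷ʳ b) ++ []) x (v ++ v₂) ∎)
    , spine-++⁺ t t₂ )
    where open ≡-Reasoning

-- Counting classes.

-- On top of an enumeration of `X`, `f` becomes a bijection from `Fin 2 × Fin p` to `Y`; finite
-- types in bijection have the same size.
double-cardinality : ∀ (X Y : Setoid 0ℓ 0ℓ) {p q} →
  let module X = Setoid X; module Y = Setoid Y in
  X HasCardinality p → Y HasCardinality q → (f : Fin 2 → X.Carrier → Y.Carrier) →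
  (∀ i {x x′} → x X.≈ x′ → f i x Y.≈ f i x′) →
  (∀ i i′ x x′ → f i x Y.≈ f i′ x′ → i ≡ i′ × x X.≈ x′) →
  (∀ y → ∃₂ λ i x → f i x Y.≈ y) →
  q ≡ 2 * p
double-cardinality X Y {p} {q} β γ f f-cong f-injective f-surjective =
  ↔⇒≡ (Inv.trans (Bij.Bijection⇒Inverse γ) (Inv.sym (Inv.trans *↔× (Bij.Bijection⇒Inverse φ))))
  where
  module Y = Setoid Y
  module β = Bijection β

  φ : Bijection (setoid (Fin 2 × Fin p)) Y
  φ = record
    { to        = λ (i , m) → f i (β.to m)
    ; cong      = λ { refl → Y.refl }
    ; bijective =
        (λ { {i , m} {i′ , m′} eq → let i≡ , x≈ = f-injective i i′ _ _ eq in
             cong₂ _,_ i≡ (β.injective x≈) })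
      , λ y → let i , x , eq = f-surjective y ; m , to-m = β.strictlySurjective x in
              (i , m) , λ { refl → Y.trans (f-cong i to-m) eq }
    }

-- The final step from a path-tree word down to a leaf is free. Taking `r` in the first tree and `l`
-- in the second gives the short paths equal step counts and makes the long paths extend them.
module _
  (A₀ B₀ A B ds₀ es : List Direction) (j : ℕ)
  (same : ∀ f → count f (ds₀ ∷ʳ r) ≡ count f es)
  (A₀≡ : A₀ ∷ʳ r ≡ ds₀ ∷ʳ r) (B₀≡ : B₀ ∷ʳ l ≡ es)
  (A≡ : A ∷ʳ r ≡ (ds₀ ∷ʳ r) ++ replicate (suc j) r) (B≡ : B ∷ʳ l ≡ es ++ replicate (suc j) l)
  where

  open Lifting ds₀ es j same
  module X = DecSetoid (ParseWords (pathTree A₀) (pathTree B₀))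
  module Y = DecSetoid (ParseWords (pathTree A) (pathTree B))

  split : ∀ (x : X.Carrier) → ∃ λ P → proj₁ x ≡ short P × Valid P
  split (w , p , q) = short⁻ (parses⇒spells A₀ r A₀≡ p) (parses⇒spells B₀ l B₀≡ q)

  lift : Fin 2 → X.Carrier → Y.Carrier
  lift i x = let P , _ , v = split x ; p , q = long⁺ i P v in
    long j i P , spells⇒parses A r A≡ p , spells⇒parses B l B≡ q

  parts-unique : ∀ {w w′} P Q → w ≡ short P → w′ ≡ short Q → Valid P → Valid Q →
                 ∀ π → map (π ⟨$⟩ʳ_) w ≡ w′ → rename π P ≡ Q
  parts-unique P Q refl refl p q π eq = short-injective (rename π P) Q
    (trans (length-map _ (before P)) (valid-≡-length P Q p q))
    (trans (sym (map-short π P)) eq)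

  -- The permutation relating two words also relates their lifts, since parts are unique and lifting
  -- commutes with renaming.
  lift-cong : ∀ i {x x′} → x X.≈ x′ → lift i x Y.≈ lift i x′
  lift-cong i {x} {x′} (π , eq) with P , p , v ← split x | Q , q , v′ ← split x′
    with refl ← parts-unique P Q p q v v′ π eq = π , map-long π j i P

  lift-injective : ∀ i i′ x x′ → lift i x Y.≈ lift i′ x′ → i ≡ i′ × x X.≈ x′
  lift-injective i i′ (w , x) (w′ , x′) (π , eq)
    with P , refl , v@(b≢c , _) ← split (w , x) | Q , refl , v′ ← split (w′ , x′)
    with refl , refl ← long-injective j i i′ (rename π P) Q (b≢c ∘ rename-injective π)
      (trans (length-map _ (before P)) (valid-≡-length P Q v v′))
      (trans (sym (map-long π j i P)) eq) =
    refl , π , map-short π P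

  unsplit : ∀ P → Valid P → X.Carrier
  unsplit P v = let p , q = short⁺ P v in
    short P , spells⇒parses A₀ r A₀≡ p , spells⇒parses B₀ l B₀≡ q

  -- `split` starts from derivations, not from `P`, but the fixed cut position leaves only one
  -- choice of parts.
  split-unsplit : ∀ P v → proj₁ (split (unsplit P v)) ≡ P
  split-unsplit P v = let Q , eq , v′ = split (unsplit P v) in
    short-injective Q P (valid-≡-length Q P v′ v) (sym eq)

  lift-surjective : ∀ y → ∃₂ λ i x → lift i x Y.≈ y
  lift-surjective (_ , p , q)
    with i , P , refl , v ← long⁻ (parses⇒spells A r A≡ p) (parses⇒spells B l B≡ q) =
    i , unsplit P v ,
    IsEquivalence.reflexive ∼-isEquivalence (cong (long j i) (split-unsplit P v))

  ∣ParseWords∣-double : ∣ParseWords∣ (pathTree A) (pathTree B) ≡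
                        2 * ∣ParseWords∣ (pathTree A₀) (pathTree B₀)
  ∣ParseWords∣-double = double-cardinality X.setoid Y.setoid
    (proj₂ (ParseWords-finite (pathTree A₀) (pathTree B₀)))
    (proj₂ (ParseWords-finite (pathTree A) (pathTree B)))
    lift (λ i {x} {x′} → lift-cong i {x} {x′}) lift-injective lift-surjective

-- Paths in the turn trees.

append-step : ∀ {A : Set} (xs : List A) n d →
  (xs ++ replicate n d) ∷ʳ d ≡ xs ++ replicate (suc n) d
append-step xs n d = trans (++-assoc xs _ _) (cong (xs ++_) (replicate-∷ʳ n d))

append-steps : ∀ {A : Set} (xs : List A) m n d →
  (xs ++ replicate (m + n) d) ∷ʳ d ≡ (xs ++ replicate m d) ++ replicate (suc n) d
append-steps xs m n d = begin
  (xs ++ replicate (m + n) d) ∷ʳ d                ≡⟨ append-step xs (m + n) d ⟩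
  xs ++ replicate (suc (m + n)) d                 ≡⟨ cong (λ i → xs ++ replicate i d) (ℕ.+-suc m n) ⟨
  xs ++ replicate (m + suc n) d                   ≡⟨ cong (xs ++_) (replicate-+ m (suc n) d) ⟩
  xs ++ replicate m d ++ replicate (suc n) d      ≡⟨ ++-assoc xs _ _ ⟨
  (xs ++ replicate m d) ++ replicate (suc n) d    ∎
  where open ≡-Reasoning

theorem15 : ∀ (m k n : ℕ) → 1 ≤ m → 1 ≤ k → k + 2 ≤ n →
    ∣ParseWords∣ (LeftTurnTree m n) (RightTurnTree k (m + n ∸ k)) ≡ 2 * a m k
theorem15 (suc m) (suc k) n _ _ k+2≤n
  -- `j` counts the letters `c` of the bridge; the combs have `j + 2` leaves.
  with j , refl ← ℕ.m≤n⇒∃[o]m+o≡n k+2≤n =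
  ∣ParseWords∣-double
    (ls ++ replicate (suc k + 1 ∸ 2) r) (rs ++ replicate (suc m + 1 ∸ 2) l)
    (ls ++ replicate (n ∸ 2) r) (rs ++ replicate (suc m + n ∸ suc k ∸ 2) l)
    -- The replaced leaf is reached by `ls ++ rs` in one tree and by `rs ++ ls` in the other; the
    -- former is passed without its last step `r`.
    (ls ++ replicate k r) (rs ++ ls) j
    (λ f → trans (cong (count f) (append-step ls k r)) (count-++-comm f ls rs))
    (cong (λ i → (ls ++ replicate i r) ∷ʳ r) (ℕ.m+n∸n≡m k 1))
    (trans (cong (λ i → (rs ++ replicate i l) ∷ʳ l) (ℕ.m+n∸n≡m m 1)) (append-step rs m l))
    (begin
      (ls ++ replicate (n ∸ 2) r) ∷ʳ r
        ≡⟨ cong (λ i → (ls ++ replicate i r) ∷ʳ r) n∸2 ⟩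
      (ls ++ replicate (suc k + j) r) ∷ʳ r
        ≡⟨ append-steps ls (suc k) j r ⟩
      (ls ++ rs) ++ replicate (suc j) r
        ≡⟨ cong (_++ replicate (suc j) r) (append-step ls k r) ⟨
      ((ls ++ replicate k r) ∷ʳ r) ++ replicate (suc j) r ∎)
    (trans (cong (λ i → (rs ++ replicate i l) ∷ʳ l) m+n∸k∸2) (append-steps rs (suc m) j l))
  where
  open ≡-Reasoning
  ls = replicate (suc m) l
  rs = replicate (suc k) r

  n≡ : n ≡ 2 + (suc k + j)
  n≡ = cong (_+ j) (ℕ.+-comm (suc k) 2)

  n∸2 : n ∸ 2 ≡ suc k + j
  n∸2 = cong (_∸ 2) n≡

  m+n∸k∸2 : suc m + n ∸ suc k ∸ 2 ≡ suc m + j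
  m+n∸k∸2 = begin
    suc m + n ∸ suc k ∸ 2                ≡⟨ ℕ.∸-+-assoc (suc m + n) (suc k) 2 ⟩
    suc m + n ∸ (suc k + 2)              ≡⟨ ℕ.+-∸-assoc (suc m) k+2≤n ⟩
    suc m + (n ∸ (suc k + 2))            ≡⟨ cong (suc m +_) (ℕ.m+n∸m≡n (suc k + 2) j) ⟩
    suc m + j                            ∎
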